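{- If $G$ is a bipartite graph, then $m_c(G) = 2$.
   Context: Graphs are finite and simple. For positive integers $p,q$ with $p/q\ge 2$, a $(p,q)$-colouring of $G$ is a map $f: V(G) \to \{0,1,\dots,p-1\}$ such that $q \leq |f(u)-f(v)| \leq p-q$ for every edge $uv$. $G$ is $(p,q)$-mixing (also written $G_{p,q}$-mixing) if any two $(p,q)$-colourings of $G$ are joined by a finite sequence of $(p,q)$-colourings of $G$ in which consecutive colourings differ on at most one vertex. The circular mixing number of $G$ is $m_c(G) = \inf\{\frac{p}{q} : p,q \text{ positive integers},\ \frac{p}{q} \ge 2,\ G \text{ is } (p,q)\text{ -mixing}\}$. -}

module Defs where

open import Data.Bool.Base using (Bool)
open import Data.Fin.Base using (Fin; toℕ)
open import Data.Integer.Base using (+_)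
open import Data.Nat.Base as ℕ using (ℕ; NonZero; _∸_; ∣_-_∣)
open import Data.Product.Base using (Σ-syntax; _×_)
open import Data.Rational.Base using (ℚ; _/_; _≤_)
open import Level using (Level; 0ℓ)
open import Relation.Binary.Construct.Closure.ReflexiveTransitive using (Star)
open import Relation.Binary.Core using (Rel)
open import Relation.Binary.Definitions using (Decidable; Irreflexive; Symmetric)
open import Relation.Binary.PropositionalEquality.Core using (_≡_; _≢_)
open import Relation.Unary using (Pred)

private
  variable
    ℓ : Level

-- Decidability of adjacency is automatic classically; constructively it is
-- part of what it means for a finite graph to be given.
record Graph : Set₁ where
  field
    order  : ℕ
    Adj    : Rel (Fin order) 0ℓ
    adj?   : Decidable Adj
    sym    : Symmetric Adj
    irrefl : Irreflexive _≡_ Adj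

  Vertex : Set
  Vertex = Fin order

open Graph using (Vertex; Adj)

Bipartite : Graph → Set
Bipartite G = Σ[ side ∈ (Vertex G → Bool) ] (∀ {u v} → Adj G u v → side u ≢ side v)

-- Truncated subtraction p ∸ q is the true difference whenever p / q ≥ 2, the
-- only range in which colourings are used below.
record Colouring (G : Graph) (p q : ℕ) : Set where
  field
    colour : Vertex G → Fin p
    proper : ∀ {u v} → Adj G u v →
             q ℕ.≤ ∣ toℕ (colour u) - toℕ (colour v) ∣ ×
             ∣ toℕ (colour u) - toℕ (colour v) ∣ ℕ.≤ p ∸ q

open Colouring using (colour)

DifferOnAtMostOne : ∀ {G p q} → Rel (Colouring G p q) 0ℓ
DifferOnAtMostOne f g =
  ∀ u v → colour f u ≢ colour g u → colour f v ≢ colour g v → u ≡ v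

-- Pointwise equal colourings are related by DifferOnAtMostOne, so Star does not
-- distinguish colourings that differ only as records or up to function
-- extensionality.
Mixing : Graph → ℕ → ℕ → Set
Mixing G p q = (f g : Colouring G p q) → Star DifferOnAtMostOne f g

2ℚ : ℚ
2ℚ = + 2 / 1

data MixingRatio (G : Graph) : Pred ℚ 0ℓ where
  ratio : ∀ p q .{{_ : NonZero p}} .{{_ : NonZero q}} →
          2ℚ ≤ + p / q → Mixing G p q → MixingRatio G (+ p / q)

IsLowerBound : Pred ℚ ℓ → ℚ → Set ℓ
IsLowerBound S x = ∀ {s} → S s → x ≤ s

-- By density of ℚ in ℝ, a rational x is the greatest rational lower bound of S
-- exactly when x is the infimum of S in ℝ.
record IsInfimum (S : Pred ℚ ℓ) (x : ℚ) : Set ℓ where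
  field
    lowerBound : IsLowerBound S x
    greatest   : ∀ {y} → IsLowerBound S y → y ≤ x

-- The infimum of an arbitrary set of rationals need not exist as a
-- rational, so "the circular mixing number of G is x" is a relation
-- rather than an equation.
CircularMixingNumberIs : Graph → ℚ → Set
CircularMixingNumberIs G x = IsInfimum (MixingRatio G) x

{-# OPTIONS --safe #-}

-- Take p = 2q + 1. Subtracting q + 1 mod p on one side of the bipartition turns
-- the condition on an edge uv (v on the shifted side) into
-- x(u) − x(v) ∈ {0, 1} mod p. If |V| ≤ q, some residue c is not used by x, and
-- cutting the cycle ℤ/p at c lifts x to an integer-valued function h with
-- h(v) ≤ h(u) ≤ h(v) + 1 on every edge. Such functions are closed under pointwise
-- minimum, so minima with a family sweeping down to 0 one vertex at a time connect
-- h to 0. Hence G is (2q + 1, q)-mixing for all large q, and (2q + 1) / q → 2.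
module Submission where

open import Defs

open import Data.Bool.Base using (Bool; true; false)
open import Data.Fin.Base using (Fin; toℕ; fromℕ<)
import Data.Fin.Properties as Fin
import Data.Integer.Base as ℤ
import Data.Integer.Properties as ℤ
open import Data.Nat.Base
open import Data.Nat.DivMod
open import Data.Nat.Divisibility
open import Data.Nat.Properties
open import Data.Nat.Tactic.RingSolver using (solve-∀)
open import Data.Product.Base using (∃; _×_; _,_; proj₁; proj₂)
open import Data.Rational.Base as ℚ using (mkℚ)
import Data.Rational.Properties as ℚ
open import Data.Rational.Unnormalised.Base as ℚᵘ using (mkℚᵘ)
import Data.Rational.Unnormalised.Properties as ℚᵘ
open import Data.Sum.Base using (_⊎_; inj₁; inj₂)
open import Function.Base using (_∘_)
open import Relation.Binary.Construct.Closure.ReflexiveTransitive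
  using (Star; ε; _◅_; _◅◅_; reverse)
open import Relation.Binary.PropositionalEquality
open import Relation.Nullary using (yes; no; contradiction)

open Graph using (Vertex; Adj; order)
open Colouring using (colour; proper)

-- Residues, quotients and divisibility.

private
  swap-last : ∀ a b c → a + b + c ≡ a + c + b
  swap-last = solve-∀

[m%n+o]%n≡[m+o]%n : ∀ m o n .{{_ : NonZero n}} → (m % n + o) % n ≡ (m + o) % n
[m%n+o]%n≡[m+o]%n m o n = begin
  (m % n + o) % n               ≡⟨ [m+kn]%n≡m%n (m % n + o) (m / n) n ⟨
  (m % n + o + m / n * n) % n   ≡⟨ cong (_% n) (swap-last (m % n) o (m / n * n)) ⟩
  (m % n + m / n * n + o) % n   ≡⟨ cong (λ z → (z + o) % n) (m≡m%n+[m/n]*n m n) ⟨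
  (m + o) % n                   ∎
  where open ≡-Reasoning

-- Going `o` further round the cycle from `m % n` either stays below `n` or wraps exactly once,
-- landing `n ∸ o` lower.
∣m%n-[m+o]%n∣≡o⊎n∸o : ∀ m o n .{{_ : NonZero n}} → o ≤ n →
  ∣ m % n - (m + o) % n ∣ ≡ o ⊎ ∣ m % n - (m + o) % n ∣ ≡ n ∸ o
∣m%n-[m+o]%n∣≡o⊎n∸o m o n o≤n
  rewrite sym ([m%n+o]%n≡[m+o]%n m o n) with m % n + o <? n
... | yes r+o<n = inj₁ (begin
  ∣ m % n - (m % n + o) % n ∣   ≡⟨ cong ∣ m % n -_∣ (m<n⇒m%n≡m r+o<n) ⟩
  ∣ m % n - m % n + o ∣         ≡⟨ ∣m-m+n∣≡n (m % n) o ⟩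
  o                             ∎)
  where open ≡-Reasoning
... | no r+o≮n = inj₂ (begin
  ∣ r - (r + o) % n ∣           ≡⟨ cong ∣ r -_∣ wrapped ⟩
  ∣ r - r ∸ (n ∸ o) ∣           ≡⟨ m≤n⇒∣n-m∣≡n∸m (m∸n≤m r (n ∸ o)) ⟩
  r ∸ (r ∸ (n ∸ o))             ≡⟨ m∸[m∸n]≡n n∸o≤r ⟩
  n ∸ o                         ∎)
  where
  open ≡-Reasoning
  r = m % n
  n∸o≤r : n ∸ o ≤ r
  n∸o≤r = m≤n+o⇒m∸n≤o n o (subst (n ≤_) (+-comm r o) (≮⇒≥ r+o≮n))
  wrapped : (r + o) % n ≡ r ∸ (n ∸ o)
  wrapped = begin
    (r + o) % n                           ≡⟨ cong (λ z → (z + o) % n) (m∸n+n≡m n∸o≤r) ⟨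
    (r ∸ (n ∸ o) + (n ∸ o) + o) % n       ≡⟨ cong (_% n) (+-assoc (r ∸ (n ∸ o)) (n ∸ o) o) ⟩
    (r ∸ (n ∸ o) + (n ∸ o + o)) % n       ≡⟨ cong (λ z → (r ∸ (n ∸ o) + z) % n) (m∸n+n≡m o≤n) ⟩
    (r ∸ (n ∸ o) + n) % n                 ≡⟨ [m+n]%n≡m%n (r ∸ (n ∸ o)) n ⟩
    (r ∸ (n ∸ o)) % n                     ≡⟨ m<n⇒m%n≡m (≤-<-trans (m∸n≤m r (n ∸ o)) (m%n<n m n)) ⟩
    r ∸ (n ∸ o)                           ∎

-- When the quotient jumps, `suc m / n * n` is at least `suc (m / n) * n`, hence above `m`. It is
-- also at most `suc m`, so it equals `suc m`.
m/n≢[1+m]/n⇒n∣1+m : ∀ m n .{{_ : NonZero n}} → suc m / n ≢ m / n → n ∣ suc m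
m/n≢[1+m]/n⇒n∣1+m m n ≢ = divides (suc m / n) (≤-antisym
  (≤-trans m<[1+m/n]*n (*-monoˡ-≤ n
    (≤∧≢⇒< (/-monoˡ-≤ n (n≤1+n m)) (≢ ∘ sym))))
  (m/n*n≤m (suc m) n))
  where
  m<[1+m/n]*n : m < suc (m / n) * n
  m<[1+m/n]*n = subst (_< suc (m / n) * n) (sym (m≡m%n+[m/n]*n m n))
    (+-monoˡ-< (m / n * n) (m%n<n m n))

n∣m∧m<n⇒m≡0 : ∀ {m n} → n ∣ m → m < n → m ≡ 0
n∣m∧m<n⇒m≡0 {zero}  _   _   = refl
n∣m∧m<n⇒m≡0 {suc _} n∣m m<n = contradiction n∣m (>⇒∤ m<n)

-- If `r ≤ s`, then `n` divides `s ∸ r`, which is below `n` and therefore zero.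
∣m+r∧∣m+s⇒s≤r : ∀ {n} m {r s} → n ∣ m + r → n ∣ m + s → s < n → s ≤ r
∣m+r∧∣m+s⇒s≤r {n} m {r} {s} n∣m+r n∣m+s s<n with ≤-total r s
... | inj₂ s≤r = s≤r
... | inj₁ r≤s = m∸n≡0⇒m≤n (n∣m∧m<n⇒m≡0
  (∣m+n∣m⇒∣n (subst (n ∣_) m+s≡ n∣m+s) n∣m+r) (≤-<-trans (m∸n≤m s r) s<n))
  where
  m+s≡ : m + s ≡ m + r + (s ∸ r)
  m+s≡ = trans (cong (m +_) (sym (m+[n∸m]≡n r≤s))) (sym (+-assoc m r (s ∸ r)))

∣m+r∧∣m+s⇒r≡s : ∀ {n} m {r s} → n ∣ m + r → n ∣ m + s → r < n → s < n → r ≡ s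
∣m+r∧∣m+s⇒r≡s m n∣m+r n∣m+s r<n s<n = ≤-antisym
  (∣m+r∧∣m+s⇒s≤r m n∣m+s n∣m+r r<n) (∣m+r∧∣m+s⇒s≤r m n∣m+r n∣m+s s<n)

-- An omitted residue, and the cycle cut there.

omitted-value : ∀ {m n} → m < n → (f : Fin m → Fin n) → ∃ λ c → ∀ i → f i ≢ c
omitted-value {m} {n} m<n f
  with c , c∉f ← Fin.¬∀⟶∃¬ n (λ c → ∃ λ i → f i ≡ c) (λ c → Fin.any? λ i → f i Fin.≟ c)
         -- Choosing a preimage of each value would inject `Fin n` into `Fin m`.
         (λ onto → <⇒≱ m<n (Fin.injective⇒≤ {f = proj₁ ∘ onto} λ {c} {d} eq →
           trans (sym (proj₂ (onto c))) (trans (cong f eq) (proj₂ (onto d)))))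
  = c , λ i fi≡c → c∉f (i , fi≡c)

-- x − y ∈ {0, 1} mod p, for residues x and y.
data Ahead (p x y : ℕ) : Set where
  level : x ≡ y → Ahead p x y
  step  : x ≡ suc y → Ahead p x y
  wrap  : x ≡ 0 → suc y ≡ p → Ahead p x y

-- In cyclic order the new values are c + 1, ..., p - 1, p, ..., p + c. Raising the lower arc,
-- rather than lowering the upper one, stays within ℕ.
cut : ℕ → ℕ → ℕ → ℕ
cut p c x with c <? x
... | yes _ = x
... | no  _ = x + p

cut-≤ : ∀ {p} c {x} → x < p → cut p c x ≤ p + p
cut-≤ {p} c {x} x<p with c <? x
... | yes _ = ≤-trans (<⇒≤ x<p) (m≤m+n p p)
... | no  _ = +-monoˡ-≤ p (<⇒≤ x<p)

cut-% : ∀ p .{{_ : NonZero p}} c x → cut p c x % p ≡ x % p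
cut-% p c x with c <? x
... | yes _ = refl
... | no  _ = [m+n]%n≡m%n x p

-- The only unit step that `cut` breaks is the one from `c` to its successor, and `y ≢ c` rules it
-- out.
cut-Ahead : ∀ {p c x y} → c < p → x ≢ c → y ≢ c → Ahead p x y →
            cut p c y ≤ cut p c x × cut p c x ≤ suc (cut p c y)
cut-Ahead _ _ _ (level refl) = ≤-refl , n≤1+n _
cut-Ahead {p} {c} {_} {y} _ x≢c y≢c (step refl) with c <? suc y | c <? y
... | yes _   | yes _   = n≤1+n y , ≤-refl
... | no  _   | no  _   = n≤1+n (y + p) , ≤-refl
... | no  c≮x | yes c<y = contradiction (m<n⇒m<1+n c<y) c≮x
... | yes c<x | no  c≮y = contradiction (≤-antisym (≮⇒≥ c≮y) (s≤s⁻¹ c<x)) y≢c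
cut-Ahead {p} {c} {_} {y} c<p x≢c y≢c (wrap refl refl) with c <? 0 | c <? y
... | yes ()  | _
... | no  _   | yes _   = n≤1+n y , ≤-refl
... | no  _   | no  c≮y = contradiction (≤-antisym (≮⇒≥ c≮y) (s≤s⁻¹ c<p)) y≢c

-- Height functions and the sweeping family.

module _ (G : Graph) (bipartite : Bipartite G) where

  private
    n    = order G
    side = proj₁ bipartite

  crossing : ∀ {u v} → Adj G u v →
             side u ≡ true × side v ≡ false ⊎ side u ≡ false × side v ≡ true
  crossing {u} {v} uv with side u | side v | proj₂ bipartite uv
  ... | true  | false | _ = inj₁ (refl , refl)
  ... | false | true  | _ = inj₂ (refl , refl)
  ... | true  | true  | ≢ = contradiction refl ≢
  ... | false | false | ≢ = contradiction refl ≢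

  IsHeight : (Vertex G → ℕ) → Set
  IsHeight h = ∀ {u v} → Adj G u v → side u ≡ true → side v ≡ false →
               h v ≤ h u × h u ≤ suc (h v)

  ⊓-isHeight : ∀ {h k} → IsHeight h → IsHeight k → IsHeight (λ v → h v ⊓ k v)
  ⊓-isHeight hH kH uv su sv
    with hv≤hu , hu≤1+hv ← hH uv su sv | kv≤ku , ku≤1+kv ← kH uv su sv
    = ⊓-mono-≤ hv≤hu kv≤ku , ⊓-mono-≤ hu≤1+hv ku≤1+kv

  -- The two sides occupy disjoint blocks, which makes ranks distinct and puts every `true` vertex
  -- above every `false` one.
  rank : Vertex G → ℕ
  rank v with side v
  ... | false = toℕ v
  ... | true  = n + toℕ v

  -- The `suc` keeps the divisor nonzero even for the empty graph.
  period : ℕ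
  period = suc (n + n)

  rank<period : ∀ v → rank v < period
  rank<period v with side v
  ... | false = m<n⇒m<1+n (<-≤-trans (Fin.toℕ<n v) (m≤m+n n n))
  ... | true  = m<n⇒m<1+n (+-monoʳ-< n (Fin.toℕ<n v))

  rank-injective : ∀ {u v} → rank u ≡ rank v → u ≡ v
  rank-injective {u} {v} eq with side u | side v
  ... | false | false = Fin.toℕ-injective eq
  ... | true  | true  = Fin.toℕ-injective (+-cancelˡ-≡ n _ _ eq)
  ... | false | true  = contradiction (subst (n ≤_) (sym eq) (m≤m+n n _)) (<⇒≱ (Fin.toℕ<n u))
  ... | true  | false = contradiction (subst (n ≤_) eq (m≤m+n n _)) (<⇒≱ (Fin.toℕ<n v))

  -- As j grows, the vertices are raised by one cyclically in order of decreasing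
  -- rank, so the side on which rank is larger is always raised first.
  sweep : ℕ → Vertex G → ℕ
  sweep j v = (j + rank v) / period

  -- The rank of `u` is at least that of `v` and exceeds it by at most one period; a whole period
  -- adds one to the quotient.
  sweep-isHeight : ∀ j → IsHeight (sweep j)
  sweep-isHeight j {u} {v} _ su sv =
    /-monoˡ-≤ period (+-monoʳ-≤ j rv≤ru) ,
    ≤-trans (/-monoˡ-≤ period (+-monoʳ-≤ j ru≤rv+period))
      (≤-reflexive (trans (cong (_/ period) (sym (+-assoc j _ period)))
        (trans (+-distrib-/-∣ʳ (j + rank v) ∣-refl)
          (trans (cong (sweep j v +_) (n/n≡1 period)) (+-comm (sweep j v) 1)))))
    where
    rv≤ru : rank v ≤ rank u
    rv≤ru rewrite su | sv = ≤-trans (<⇒≤ (Fin.toℕ<n v)) (m≤m+n n (toℕ u))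
    ru≤rv+period : rank u ≤ rank v + period
    ru≤rv+period = ≤-trans (<⇒≤ (rank<period u)) (m≤n+m period (rank v))

  -- A vertex is raised only when `period` divides `suc j` plus its rank. Ranks are distinct and
  -- below `period`, so this singles out one vertex.
  sweep-step : ∀ j u v → sweep (suc j) u ≢ sweep j u → sweep (suc j) v ≢ sweep j v → u ≡ v
  sweep-step j u v ≢u ≢v = rank-injective (∣m+r∧∣m+s⇒r≡s (suc j)
    (m/n≢[1+m]/n⇒n∣1+m (j + rank u) period ≢u)
    (m/n≢[1+m]/n⇒n∣1+m (j + rank v) period ≢v)
    (rank<period u) (rank<period v))

  sweep-zero : ∀ v → sweep 0 v ≡ 0
  sweep-zero v = m<n⇒m/n≡0 (rank<period v)

  sweep-large : ∀ m v → m ≤ sweep (m * period) v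
  sweep-large m v = subst (_≤ sweep (m * period) v) (m*n/n≡m m period)
    (/-monoˡ-≤ period (m≤m+n (m * period) (rank v)))

  -- From heights to colourings, and paths to a common colouring.

  module _ (q : ℕ) where

    private
      p = suc (q + q)

      p∸q : p ∸ q ≡ suc q
      p∸q = m+n∸n≡m (suc q) q

      p∸[1+q] : p ∸ suc q ≡ q
      p∸[1+q] = m+n∸n≡m q q

    -- As p = 2q + 1, the only distances allowed are `q` and `suc q`.
    Near : ℕ → ℕ → Set
    Near a b = q ≤ ∣ a - b ∣ × ∣ a - b ∣ ≤ p ∸ q

    Near-sym : ∀ {a b} → Near a b → Near b a
    Near-sym {a} {b} = subst (λ d → q ≤ d × d ≤ p ∸ q) (∣-∣-comm a b)

    near : ∀ a b → ∣ a - b ∣ ≡ q ⊎ ∣ a - b ∣ ≡ suc q → Near a b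
    near a b (inj₁ eq) rewrite eq | p∸q = ≤-refl , n≤1+n q
    near a b (inj₂ eq) rewrite eq | p∸q = n≤1+n q , ≤-refl

    near⁻¹ : ∀ {a b} → Near a b → ∣ a - b ∣ ≡ q ⊎ ∣ a - b ∣ ≡ suc q
    near⁻¹ (q≤d , d≤p∸q) with m≤n⇒m<n∨m≡n q≤d
    ... | inj₁ q<d = inj₂ (≤-antisym (≤-trans d≤p∸q (≤-reflexive p∸q)) q<d)
    ... | inj₂ q≡d = inj₁ (sym q≡d)

    -- The `false` side is turned about half way round the cycle, so equal heights become nearly
    -- antipodal colours.
    offset : Bool → ℕ
    offset true  = 0
    offset false = suc q

    heightColour : (Vertex G → ℕ) → Vertex G → Fin p
    heightColour h v = (h v + offset (side v)) mod p

    toℕ-heightColour : ∀ h v → toℕ (heightColour h v) ≡ (h v + offset (side v)) % p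
    toℕ-heightColour h v = Fin.toℕ-fromℕ< _

    -- The second colour lies `suc q` beyond the first if `x ≡ y`, and `q` beyond it if `x ≡ suc y`.
    -- These shifts add up to `p`, so wrapping merely exchanges the two allowed distances.
    near-offset : ∀ {x y} → y ≤ x → x ≤ suc y → Near ((x + 0) % p) ((y + suc q) % p)
    near-offset {x} {y} y≤x x≤1+y rewrite +-identityʳ x with m≤n⇒m<n∨m≡n y≤x
    ... | inj₂ refl = near (y % p) ((y + suc q) % p) (swapped (∣m%n-[m+o]%n∣≡o⊎n∸o y (suc q) p (s≤s (m≤m+n q q))))
      where
      swapped : ∀ {d} → d ≡ suc q ⊎ d ≡ p ∸ suc q → d ≡ q ⊎ d ≡ suc q
      swapped (inj₁ eq) = inj₂ eq
      swapped (inj₂ eq) = inj₁ (trans eq p∸[1+q])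
    ... | inj₁ y<x with refl ← ≤-antisym x≤1+y y<x rewrite +-suc y q
      = near (suc y % p) ((suc y + q) % p) (direct (∣m%n-[m+o]%n∣≡o⊎n∸o (suc y) q p (m≤n⇒m≤1+n (m≤m+n q q))))
      where
      direct : ∀ {d} → d ≡ q ⊎ d ≡ p ∸ q → d ≡ q ⊎ d ≡ suc q
      direct (inj₁ eq) = inj₁ eq
      direct (inj₂ eq) = inj₂ (trans eq p∸q)

    heightColouring : ∀ h → IsHeight h → Colouring G p q
    heightColouring h hH = record { colour = heightColour h ; proper = isProper }
      where
      oriented : ∀ {u v} → Adj G u v → side u ≡ true → side v ≡ false →
                 Near (toℕ (heightColour h u)) (toℕ (heightColour h v))
      oriented {u} {v} uv su sv
        rewrite toℕ-heightColour h u | toℕ-heightColour h v | su | sv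
        with hv≤hu , hu≤1+hv ← hH uv su sv = near-offset hv≤hu hu≤1+hv

      isProper : ∀ {u v} → Adj G u v → Near (toℕ (heightColour h u)) (toℕ (heightColour h v))
      isProper {u} {v} uv with crossing uv
      ... | inj₁ (su , sv) = oriented uv su sv
      ... | inj₂ (su , sv) = Near-sym {toℕ (heightColour h v)} (oriented (Graph.sym G uv) sv su)

    pointwise⇒step : {f g : Colouring G p q} → (∀ v → colour f v ≡ colour g v) →
                     DifferOnAtMostOne f g
    pointwise⇒step f≗g u _ fu≢gu _ = contradiction (f≗g u) fu≢gu

    private
      heightColour-cong : ∀ h k v → h v ≡ k v → heightColour h v ≡ heightColour k v
      heightColour-cong _ _ v = cong (λ x → (x + offset (side v)) mod p)

    bottom : Colouring G p q
    bottom = heightColouring (λ _ → 0) (λ _ _ _ → z≤n , z≤n)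

    -- Cap `h` by `sweep j`. At `j = m * period` the cap is at least `m` and has no effect; at
    -- `j = 0` it is zero; each decrement of `j` lowers the cap at no more than one vertex.
    heightColouring⟶bottom : ∀ h (hH : IsHeight h) m → (∀ v → h v ≤ m) →
                             Star DifferOnAtMostOne (heightColouring h hH) bottom
    heightColouring⟶bottom h hH m h≤m =
      pointwise⇒step {heightColouring h hH} {truncated (m * period)}
        (λ v → heightColour-cong h (λ v → h v ⊓ sweep (m * period) v) v
          (sym (m≤n⇒m⊓n≡m (≤-trans (h≤m v) (sweep-large m v)))))
      ◅ descend (m * period)
      where
      truncated : ℕ → Colouring G p q
      truncated j = heightColouring (λ v → h v ⊓ sweep j v) (⊓-isHeight hH (sweep-isHeight j))

      descend : ∀ j → Star DifferOnAtMostOne (truncated j) bottom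
      descend zero    = pointwise⇒step {truncated 0} {bottom}
        (λ v → heightColour-cong (λ v → h v ⊓ sweep 0 v) (λ _ → 0) v
          (trans (cong (h v ⊓_) (sweep-zero v)) (⊓-zeroʳ (h v)))) ◅ ε
      descend (suc j) = (λ u v ≢u ≢v → sweep-step j u v (moved u ≢u) (moved v ≢v)) ◅ descend j
        where
        moved : ∀ v → colour (truncated (suc j)) v ≢ colour (truncated j) v →
                sweep (suc j) v ≢ sweep j v
        moved v ≢ eq = ≢ (heightColour-cong
          (λ v → h v ⊓ sweep (suc j) v) (λ v → h v ⊓ sweep j v) v (cong (h v ⊓_) eq))

    -- From colourings to heights.

    -- Inverse to adding offset, since q + suc q ≡ 0 mod p.
    residue : Bool → ℕ → ℕ
    residue true  a = a
    residue false a = (a + q) % p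

    residue-< : ∀ s {a} → a < p → residue s a < p
    residue-< true      a<p = a<p
    residue-< false {a} _   = m%n<n (a + q) p

    residue-offset : ∀ s {a} → a < p → (residue s a + offset s) % p ≡ a
    residue-offset true  {a} a<p = trans (cong (_% p) (+-identityʳ a)) (m<n⇒m%n≡m a<p)
    residue-offset false {a} a<p = begin
      ((a + q) % p + suc q) % p   ≡⟨ [m%n+o]%n≡[m+o]%n (a + q) (suc q) p ⟩
      (a + q + suc q) % p         ≡⟨ cong (_% p) (regroup a q) ⟩
      (a + p) % p                 ≡⟨ [m+n]%n≡m%n a p ⟩
      a % p                       ≡⟨ m<n⇒m%n≡m a<p ⟩
      a                           ∎
      where
      open ≡-Reasoning
      regroup : ∀ a q → a + q + suc q ≡ a + suc (q + q)
      regroup = solve-∀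

    -- Modulo `p`, adding `q` to `b` subtracts `suc q`. The order of `a` and `b` and their distance
    -- give four cases, each with `b + q` congruent to `a` or to `a` - 1.
    near⇒Ahead : ∀ {a b} → a < p → b < p → Near a b →
                 Ahead p (residue true a) (residue false b)
    near⇒Ahead {a} {b} a<p b<p nearab with ≤-total a b | near⁻¹ {a} {b} nearab
    ... | inj₁ a≤b | inj₁ d≡q = above a a<p b≡a+q
      where
      b≡a+q : b ≡ a + q
      b≡a+q = trans (sym (m+[n∸m]≡n a≤b)) (cong (a +_) (trans (sym (m≤n⇒∣m-n∣≡n∸m a≤b)) d≡q))
      above : ∀ a → a < p → b ≡ a + q → Ahead p a ((b + q) % p)
      -- Here `b` is `q`, with residue 2q = p - 1, the cyclic predecessor of 0.
      above zero    _     refl = wrap refl (cong suc (m<n⇒m%n≡m ≤-refl))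
      above (suc a) 1+a<p refl = step (cong suc (sym (begin
        (suc a + q + q) % p     ≡⟨ cong (_% p) (regroup a q) ⟩
        (a + p) % p             ≡⟨ [m+n]%n≡m%n a p ⟩
        a % p                   ≡⟨ m<n⇒m%n≡m (<-trans (n<1+n a) 1+a<p) ⟩
        a                       ∎)))
        where
        open ≡-Reasoning
        regroup : ∀ a q → suc a + q + q ≡ a + suc (q + q)
        regroup = solve-∀
    ... | inj₁ a≤b | inj₂ d≡1+q = level (sym (begin
      (b + q) % p               ≡⟨ cong (λ z → (z + q) % p) (trans (sym (m+[n∸m]≡n a≤b))
                                     (cong (a +_) (trans (sym (m≤n⇒∣m-n∣≡n∸m a≤b)) d≡1+q))) ⟩
      (a + suc q + q) % p       ≡⟨ cong (_% p) (+-assoc a (suc q) q) ⟩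
      (a + p) % p               ≡⟨ [m+n]%n≡m%n a p ⟩
      a % p                     ≡⟨ m<n⇒m%n≡m a<p ⟩
      a                         ∎))
      where open ≡-Reasoning
    ... | inj₂ b≤a | inj₁ d≡q = level (sym (trans (cong (_% p) b+q≡a) (m<n⇒m%n≡m a<p)))
      where
      b+q≡a : b + q ≡ a
      b+q≡a = trans (cong (b +_) (trans (sym d≡q) (m≤n⇒∣n-m∣≡n∸m b≤a))) (m+[n∸m]≡n b≤a)
    ... | inj₂ b≤a | inj₂ d≡1+q = step (trans (sym 1+b+q≡a) (cong suc (sym
      (m<n⇒m%n≡m (<-trans (subst (b + q <_) 1+b+q≡a (n<1+n (b + q))) a<p)))))
      where
      1+b+q≡a : suc (b + q) ≡ a
      1+b+q≡a = trans (sym (+-suc b q))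
        (trans (cong (b +_) (trans (sym d≡1+q) (m≤n⇒∣n-m∣≡n∸m b≤a))) (m+[n∸m]≡n b≤a))

    module _ (n≤q : n ≤ q) (f : Colouring G p q) where

      private
        x : Vertex G → ℕ
        x v = residue (side v) (toℕ (colour f v))

        x<p : ∀ v → x v < p
        x<p v = residue-< (side v) (Fin.toℕ<n (colour f v))

        omitted : ∃ λ c → ∀ v → fromℕ< (x<p v) ≢ c
        -- The `n` vertices cannot use all residues, since n ≤ q < 2q + 1.
        omitted = omitted-value (s≤s (≤-trans n≤q (m≤m+n q q))) (λ v → fromℕ< (x<p v))

        c : ℕ
        c = toℕ (proj₁ omitted)

        x≢c : ∀ v → x v ≢ c
        x≢c v eq = proj₂ omitted v (Fin.toℕ-injective (trans (Fin.toℕ-fromℕ< (x<p v)) eq))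

      lift : Vertex G → ℕ
      lift v = cut p c (x v)

      lift-isHeight : IsHeight lift
      lift-isHeight {u} {v} uv su sv =
        cut-Ahead (Fin.toℕ<n (proj₁ omitted)) (x≢c u) (x≢c v) ahead
        where
        ahead : Ahead p (x u) (x v)
        ahead rewrite su | sv =
          near⇒Ahead (Fin.toℕ<n (colour f u)) (Fin.toℕ<n (colour f v)) (proper f uv)

      -- Cutting alters a residue only by a multiple of `p`, and adding `offset` undoes `residue`.
      colour-lift : ∀ v → colour f v ≡ heightColour lift v
      colour-lift v = Fin.toℕ-injective (sym (begin
        toℕ (heightColour lift v)           ≡⟨ toℕ-heightColour lift v ⟩
        (lift v + o) % p                    ≡⟨ [m%n+o]%n≡[m+o]%n (lift v) o p ⟨
        (lift v % p + o) % p                ≡⟨ cong (λ z → (z + o) % p) (cut-% p c (x v)) ⟩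
        (x v % p + o) % p                   ≡⟨ [m%n+o]%n≡[m+o]%n (x v) o p ⟩
        (x v + o) % p                       ≡⟨ residue-offset (side v) (Fin.toℕ<n (colour f v)) ⟩
        toℕ (colour f v)                    ∎))
        where
        open ≡-Reasoning
        o = offset (side v)

      colouring⟶bottom : Star DifferOnAtMostOne f bottom
      colouring⟶bottom =
        pointwise⇒step {f} {heightColouring lift lift-isHeight} colour-lift ◅
        heightColouring⟶bottom lift lift-isHeight (p + p) (λ v → cut-≤ c (x<p v))

    -- Both colourings reach `bottom`, and recolouring steps are reversible.
    mixing : n ≤ q → Mixing G p q
    mixing n≤q f g = colouring⟶bottom n≤q f ◅◅
      reverse (λ f~g u v ≢u ≢v → f~g u v (≢u ∘ sym) (≢v ∘ sym)) (colouring⟶bottom n≤q g)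

-- The ratios (2q + 1)/q and their limit 2.

2≤[1+2q]/q : ∀ q .{{_ : NonZero q}} → 2ℚ ℚ.≤ ℤ.+ suc (q + q) ℚ./ q
2≤[1+2q]/q q@(suc q-1) = ℚ.toℚᵘ-cancel-≤
  (ℚᵘ.≤-respʳ-≃ (ℚᵘ.≃-sym (ℚ.toℚᵘ-fromℚᵘ (mkℚᵘ (ℤ.+ suc (q + q)) q-1)))
    (ℚᵘ.*≤* (ℤ.+≤+ 2q≤)))
  where
  2q≤ : 2 * q ≤ suc (q + q) * 1
  2q≤ = ≤-trans (n≤1+n (2 * q)) (≤-reflexive (expand q))
    where
    expand : ∀ q → suc (2 * q) ≡ suc (q + q) * 1
    expand = solve-∀

-- Write y = a/b. For q > b, the bound gives aq ≤ (2q + 1)b < (2b + 1)q, so a < 2b + 1, and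
-- integrality yields a ≤ 2b.
≤[1+2q]/q⇒≤2 : ∀ {y} n → (∀ q .{{_ : NonZero q}} → n ≤ q → y ℚ.≤ ℤ.+ suc (q + q) ℚ./ q) → y ℚ.≤ 2ℚ
≤[1+2q]/q⇒≤2 {y@(mkℚ a b-1 _)} n y≤ = ℚ.*≤* (subst₂ ℤ._≤_ (sym (ℤ.*-identityʳ a)) (ℤ.pos-* 2 b)
  (ℤ.i<j⇒i≤pred[j] {j = ℤ.+ suc (2 * b)} (ℤ.*-cancelʳ-<-nonNeg (ℤ.+ q) (ℤ.≤-<-trans aq≤ (ℤ.+<+ [1+2q]b<)))))
  where
  b = suc b-1
  -- Large enough both for the hypothesis, `n ≤ q`, and for the strict inequality, `b < q`.
  q = suc (n + b)
  aq≤ : a ℤ.* ℤ.+ q ℤ.≤ ℤ.+ (suc (q + q) * b)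
  aq≤ = ℚᵘ.drop-*≤* (ℚᵘ.≤-respʳ-≃ (ℚ.toℚᵘ-fromℚᵘ (mkℚᵘ (ℤ.+ suc (q + q)) (n + b)))
    (ℚ.toℚᵘ-mono-≤ (y≤ q (m≤n⇒m≤1+n (m≤m+n n b)))))
  [1+2q]b< : suc (q + q) * b < suc (2 * b) * q
  [1+2q]b< = subst (suc (q + q) * b <_) (expand q b) (+-monoˡ-< ((q + q) * b) (s≤s (m≤n+m b n)))
    where
    expand : ∀ q b → q + (q + q) * b ≡ suc (2 * b) * q
    expand = solve-∀

corollary4p13 : (G : Graph) → Bipartite G → CircularMixingNumberIs G 2ℚ
corollary4p13 G bipartite = record
  -- Every mixing ratio carries its own proof of being at least 2.
  { lowerBound = λ { (ratio p q 2≤p/q _) → 2≤p/q }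
  ; greatest   = λ y≤S → ≤[1+2q]/q⇒≤2 (order G) λ q n≤q →
      y≤S (ratio (suc (q + q)) q (2≤[1+2q]/q q) (mixing G bipartite q n≤q))
  }
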